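{- Let $F$ be a finite forest each of whose connected components is a caterpillar with at least one edge. Then $F$ is odd-graceful.
   Context: A caterpillar is a tree with the property that removing all of its end vertices (leaves) leaves a path. A graph $G$ with $n$ edges is odd-graceful if there is an injective map $f:V(G)\to\{0,1,2,\dots,2n-1\}$ such that the set of induced edge weights $\{|f(x)-f(y)| : xy\in E(G)\}$ equals $\{1,3,5,\dots,2n-1\}$. -}

module Defs where

open import Data.Fin.Base as Fin using (Fin; toℕ; fromℕ; inject₁)
import Data.Fin.Properties as Fin
open import Data.List.Base using (List; length; filter; cartesianProduct; allFin)
open import Data.Nat.Base using (ℕ; suc; _+_; _*_; _<_; ∣_-_∣)
open import Data.Nat.Properties using (1+n≢n)
open import Data.Product.Base using (_×_; _,_; ∃; ∃₂; uncurry)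
open import Data.Product using (∃!)
open import Data.Refinement.Base using (Refinement-syntax; value)
open import Data.Sum.Base using (_⊎_; inj₁; inj₂; swap)
open import Function.Base using (_∘_)
open import Function.Bundles using (_↔_; _⇔_; module Inverse)
open import Function.Definitions using (Injective)
open import Level using (0ℓ)
open import Relation.Binary.Construct.Closure.ReflexiveTransitive using (Star)
open import Relation.Binary.Core using (Rel)
open import Relation.Binary.Definitions using (Symmetric; Decidable)
open import Relation.Binary.PropositionalEquality.Core using (_≡_; sym)
open import Relation.Nullary.Decidable.Core using (_×-dec_)
open import Relation.Nullary.Negation.Core using (¬_)
open import Relation.Unary using (Pred; _≐_)

record Graph : Set₁ where
  infix 4 _~_
  field
    Vertex   : Set
    _~_      : Rel Vertex 0ℓ
    ~-sym    : Symmetric _~_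
    ~-irrefl : ∀ {x} → ¬ (x ~ x)

-- The membership proof in a refinement type is irrelevant, so two vertices
-- of an induced subgraph are equal as soon as they are equal in G.
induced : (G : Graph) → Pred (Graph.Vertex G) 0ℓ → Graph
induced G P = record
  { Vertex   = [ x ∈ Vertex ∣ P x ]
  ; _~_      = λ x y → value x ~ value y
  ; ~-sym    = ~-sym
  ; ~-irrefl = ~-irrefl
  }
  where open Graph G

record _≅_ (G H : Graph) : Set where
  private
    module G = Graph G
    module H = Graph H
  field
    bijection : G.Vertex ↔ H.Vertex
  open Inverse bijection using (to)
  field
    adjacency : ∀ x y → (x G.~ y) ⇔ (to x H.~ to y)

-- The path on k vertices; k = 0 (the null graph) is allowed.
pathGraph : ℕ → Graph
pathGraph k = record
  { Vertex   = Fin k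
  ; _~_      = λ i j → toℕ j ≡ suc (toℕ i) ⊎ toℕ i ≡ suc (toℕ j)
  ; ~-sym    = swap
  ; ~-irrefl = λ { (inj₁ e) → 1+n≢n (sym e) ; (inj₂ e) → 1+n≢n (sym e) }
  }

IsPath : Graph → Set
IsPath G = ∃ λ k → G ≅ pathGraph k

module _ (G : Graph) where
  open Graph G

  HasEdge : Set
  HasEdge = ∃₂ λ x y → x ~ y

  Reachable : Rel Vertex 0ℓ
  Reachable = Star _~_

  component : Vertex → Graph
  component x = induced G (Reachable x)

  -- The null graph is not connected.
  Connected : Set
  Connected = Vertex × (∀ x y → Reachable x y)

  record Cycle : Set where
    field
      {excess}  : ℕ
      vertex    : Fin (3 + excess) → Vertex
      injective : Injective _≡_ _≡_ vertex
      step      : ∀ (i : Fin (2 + excess)) → vertex (inject₁ i) ~ vertex (Fin.suc i)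
      close     : vertex (fromℕ (2 + excess)) ~ vertex Fin.zero

  IsForest : Set
  IsForest = ¬ Cycle

  IsTree : Set
  IsTree = Connected × IsForest

  IsLeaf : Pred Vertex 0ℓ
  IsLeaf x = ∃! _≡_ (x ~_)

  removeLeaves : Graph
  removeLeaves = induced G (λ x → ¬ IsLeaf x)

IsCaterpillar : Graph → Set
IsCaterpillar G = IsTree G × IsPath (removeLeaves G)

record FiniteGraph : Set₁ where
  infix 4 _~?_
  field
    graph : Graph
  open Graph graph public
  field
    {order}     : ℕ
    enumeration : Vertex ↔ Fin order
    _~?_        : Decidable _~_

  vertexAt : Fin order → Vertex
  vertexAt = Inverse.from enumeration

  -- Each unordered edge is listed once, as a pair of indices i < j.
  edges : List (Fin order × Fin order)
  edges = filter (uncurry λ i j → (i Fin.<? j) ×-dec (vertexAt i ~? vertexAt j))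
                 (cartesianProduct (allFin order) (allFin order))

  edgeCount : ℕ
  edgeCount = length edges

-- {1, 3, …, 2n − 1}
firstOdds : ℕ → Pred ℕ 0ℓ
firstOdds n w = ∃ λ i → i < n × w ≡ 2 * i + 1

module _ (G : FiniteGraph) where
  open FiniteGraph G

  inducedWeights : (Vertex → ℕ) → Pred ℕ 0ℓ
  inducedWeights f w = ∃₂ λ x y → x ~ y × w ≡ ∣ f x - f y ∣

  OddGraceful : Set
  OddGraceful = ∃ λ (f : Vertex → Fin (2 * edgeCount)) →
    Injective _≡_ _≡_ f × inducedWeights (toℕ ∘ f) ≐ firstOdds edgeCount

{-# OPTIONS --safe #-}
module Submission where

-- A labelled vertex set S spanning n edges keeps its labels in 0, …, 2n − 1 and
-- its edge weights equal to 1, 3, …, 2n − 1.  Three moves preserve this: joining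
-- a new vertex, labelled 2n + 1, to the vertex labelled 0; replacing every label
-- a by 2n − 1 − a, which puts the last joined vertex at 0; and, for a new
-- component, adding 1 to every label and giving 0 to a new isolated vertex, to
-- which the next vertex is joined at once.  A caterpillar is built by walking
-- along its spine: all leaves at the current spine vertex (labelled 0) are
-- joined to it, then the next spine vertex is, and the labels are complemented.

open import Defs
open import Data.Empty using (⊥-elim-irr)
open import Data.Bool.Base using (if_then_else_)
open import Data.Fin.Base as Fin using (Fin; toℕ; fromℕ; fromℕ<; inject₁)
open import Data.Fin.Induction using (<-weakInduction)
import Data.Fin.Properties as Fin
open import Data.Irrelevant as Irrelevant using (Irrelevant; [_])
open import Data.List.Base using (List; []; _∷_; length; map; applyDownFrom; allFin; cartesianProduct)
import Data.List.Membership.DecPropositional as DecMembership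
open import Data.List.Membership.Propositional using (_∈_; _∉_)
open import Data.List.Membership.Propositional.Properties
open import Data.List.Membership.Propositional.Properties.WithK using (unique∧set⇒bag)
open import Data.List.Properties using (length-map; map-cong-local; map-∘)
open import Data.List.Relation.Binary.BagAndSetEquality using (_∼[_]_; set; ∼bag⇒↭)
open import Data.List.Relation.Binary.Permutation.Propositional.Properties using (↭-length)
open import Data.List.Relation.Binary.Subset.Propositional using (_⊆_)
open import Data.List.Relation.Unary.All as All using (All; []; _∷_)
open import Data.List.Relation.Unary.Any using (here; there)
open import Data.List.Relation.Unary.Unique.Propositional using (Unique)
import Data.List.Relation.Unary.Unique.Propositional.Properties as Unique
open import Data.Nat.Base
open import Data.Nat.Properties hiding (_≟_)
open import Data.Product.Base using (_×_; _,_; ∃; proj₁; proj₂)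
open import Data.Refinement.Base using (value; proof; _,_)
open import Data.Refinement.Properties using (value-injective)
open import Data.Sum.Base as Sum using (_⊎_; inj₁; inj₂)
open import Function.Base using (_∘_; case_of_)
open import Function.Bundles using (_⇔_; mk⇔; module Equivalence; module Inverse)
open import Function.Definitions using (Injective)
open import Function.Properties.Inverse using (Inverse⇒Injection)
open import Level using (0ℓ)
open import Relation.Binary.Construct.Closure.ReflexiveTransitive as Star using (ε; _◅_; _◅◅_)
open import Relation.Binary.Definitions using (DecidableEquality)
open import Relation.Binary.PropositionalEquality
  using (_≡_; _≢_; refl; sym; trans; cong; cong₂; subst; subst₂)
open import Relation.Nullary using (¬_; yes; no; does; contradiction)
open import Relation.Nullary.Decidable
  using (via-injection; dec-true; dec-false; decidable-stable; ¬?; _×-dec_)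
open import Relation.Unary using (Pred; Decidable; _≐_; _∪_; _∩_)

-- Reflection in `o` reverses the order but keeps distances; the two bounds make the truncated
-- subtractions exact. Edge weights therefore survive complementing the labels.
∣∸-∸∣ : ∀ {m n o} → m ≤ o → n ≤ o → ∣ o ∸ m - o ∸ n ∣ ≡ ∣ m - n ∣
∣∸-∸∣ {n = n} {o} z≤n n≤o =
  trans (∣-∣-comm o (o ∸ n)) (trans (m≤n⇒∣m-n∣≡n∸m (m∸n≤m o n)) (m∸[m∸n]≡n n≤o))
∣∸-∸∣ {m} {o = o} m≤o@(s≤s _) z≤n = trans (m≤n⇒∣m-n∣≡n∸m (m∸n≤m o m)) (m∸[m∸n]≡n m≤o)
∣∸-∸∣ (s≤s m≤o) (s≤s n≤o) = ∣∸-∸∣ m≤o n≤o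

-- Labelled vertex sets and the moves on them.

module _ (F : FiniteGraph) where
  open FiniteGraph F

  _≟_ : DecidableEquality Vertex
  _≟_ = via-injection (Inverse⇒Injection enumeration) Fin._≟_

  open DecMembership _≟_ using (_∈?_)

  infixl 9 _[_≔_]
  _[_≔_] : (Vertex → ℕ) → Vertex → ℕ → Vertex → ℕ
  (f [ v ≔ k ]) x = if does (x ≟ v) then k else f x

  lookup-≔ : ∀ f v k → (f [ v ≔ k ]) v ≡ k
  lookup-≔ f v k rewrite dec-true (v ≟ v) refl = refl

  lookup-≔-fresh : ∀ f {v} k {S x} → v ∉ S → x ∈ S → (f [ v ≔ k ]) x ≡ f x
  lookup-≔-fresh f {v} k {x = x} v∉S x∈S
    rewrite dec-false (x ≟ v) (λ { refl → v∉S x∈S }) = refl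

  weight : (Vertex → ℕ) → Vertex × Vertex → ℕ
  weight f (x , y) = ∣ f x - f y ∣

  odd : ℕ → ℕ
  odd i = 2 * i + 1

  -- slack 1 allows the label 2n, reached after isolating a vertex but before joining one to it.
  record Labelling (slack : ℕ) (S : List Vertex) : Set where
    field
      links : List (Vertex × Vertex)
      label : Vertex → ℕ

    size : ℕ
    size = length links

    field
      bounded        : ∀ {x} → x ∈ S → label x < slack + 2 * size
      injective      : ∀ {x y} → x ∈ S → y ∈ S → label x ≡ label y → x ≡ y
      links-sound    : All (λ (x , y) → x ∈ S × y ∈ S × x ~ y) links
      links-complete : ∀ {x y} → x ∈ S → y ∈ S → x ~ y → (x , y) ∈ links ⊎ (y , x) ∈ links
      -- The newest link comes first and is the heaviest, so the weights form a decreasing list.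
      -- Equality of lists also records that they are pairwise distinct.
      weights        : map (weight label) links ≡ applyDownFrom odd size

  open Labelling

  loosen : ∀ {S} → Labelling 0 S → Labelling 1 S
  loosen L = record
    { links = links L ; label = label L ; bounded = m≤n⇒m≤1+n ∘ bounded L
    ; injective = injective L ; links-sound = links-sound L
    ; links-complete = links-complete L ; weights = weights L }

  empty : Labelling 0 []
  empty = record
    { links = [] ; label = λ _ → 0 ; bounded = λ () ; injective = λ () ; links-sound = []
    ; links-complete = λ () ; weights = refl }

  flip : ∀ {S} → Labelling 0 S → Labelling 0 S
  flip {S} L = record L
    -- This is 2n - 1 - a. With slack 0, `bounded` is literally `suc a ≤ 2 * size L`, so nothing is
    -- truncated.
    { label     = λ x → 2 * size L ∸ suc (label L x)
    ; bounded   = λ x∈S → ∸-monoʳ-< z<s (bounded L x∈S)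
    ; injective = λ x∈S y∈S e →
        injective L x∈S y∈S (suc-injective (∸-cancelˡ-≡ (bounded L x∈S) (bounded L y∈S) e))
    ; weights   = trans
        (map-cong-local (All.map (λ (x∈S , y∈S , _) → ∣∸-∸∣ (bounded L x∈S) (bounded L y∈S))
                                 (links-sound L)))
        (weights L)
    }

  -- The shift keeps all differences and frees the label 0. The number of edges stays n while the
  -- largest label may become 2n, whence slack 1.
  isolate : ∀ {S u} (L : Labelling 0 S) → u ∉ S → (∀ {z} → z ∈ S → ¬ u ~ z) →
            ∃ λ (L′ : Labelling 1 (u ∷ S)) → label L′ u ≡ 0
  isolate {S} {u} L u∉S u≁S = record
    { links          = links L
    ; label          = f
    ; bounded        = λ where
        (here refl) → subst (_< 1 + 2 * size L) (sym new) z<s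
        (there x∈S) → subst (_< 1 + 2 * size L) (sym (old x∈S)) (s<s (bounded L x∈S))
    ; injective      = λ where
        (here refl) (here refl) e → refl
        (here refl) (there y∈S) e → contradiction (trans (sym new) (trans e (old y∈S))) 0≢1+n
        (there x∈S) (here refl) e → contradiction (trans (sym new) (trans (sym e) (old x∈S))) 0≢1+n
        (there x∈S) (there y∈S) e → injective L x∈S y∈S
          (suc-injective (trans (sym (old x∈S)) (trans e (old y∈S))))
    ; links-sound    = All.map (λ (x∈S , y∈S , x~y) → there x∈S , there y∈S , x~y) (links-sound L)
    ; links-complete = λ where
        (here refl) (here refl) u~u → contradiction u~u ~-irrefl
        (here refl) (there y∈S) u~y → contradiction u~y (u≁S y∈S)
        (there x∈S) (here refl) x~u → contradiction (~-sym x~u) (u≁S x∈S)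
        (there x∈S) (there y∈S) x~y → links-complete L x∈S y∈S x~y
    ; weights        = trans
        (map-cong-local (All.map (λ (x∈S , y∈S , _) → cong₂ ∣_-_∣ (old x∈S) (old y∈S))
                                 (links-sound L)))
        (weights L)
    } , new
    where
    f : Vertex → ℕ
    f = (suc ∘ label L) [ u ≔ 0 ]
    new : f u ≡ 0
    new = lookup-≔ (suc ∘ label L) u 0
    old : ∀ {x} → x ∈ S → f x ≡ suc (label L x)
    old = lookup-≔-fresh (suc ∘ label L) 0 u∉S

  -- With slack 1 all labels are at most 2n, so 2n + 1 is new, and the edge to the vertex at 0 gets
  -- the next odd weight. There are now n + 1 edges, which brings the slack back to 0. The last
  -- component says that `y` holds the top label, the one that `flip` sends to 0.
  attach : ∀ {S c y} (L : Labelling 1 S) → c ∈ S → label L c ≡ 0 →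
           y ∉ S → c ~ y → (∀ {z} → z ∈ S → y ~ z → z ≡ c) →
           ∃ λ (L′ : Labelling 0 (y ∷ S)) → label L′ c ≡ 0 × suc (label L′ y) ≡ 2 * size L′
  attach {S} {c} {y} L c∈S fc≡0 y∉S c~y y~S = record
    { links          = (c , y) ∷ links L
    ; label          = f
    ; bounded        = λ where
        (here refl) → ≤-reflexive top
        (there x∈S) → <-trans (below x∈S) (≤-reflexive top)
    ; injective      = λ where
        (here refl) (here refl) e → refl
        (here refl) (there z∈S) e → contradiction (sym e) (<⇒≢ (below z∈S))
        (there x∈S) (here refl) e → contradiction e (<⇒≢ (below x∈S))
        (there x∈S) (there z∈S) e → injective L x∈S z∈S
          (trans (sym (old x∈S)) (trans e (old z∈S)))
    ; links-sound    = (there c∈S , here refl , c~y) ∷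
        All.map (λ (x∈S , z∈S , x~z) → there x∈S , there z∈S , x~z) (links-sound L)
    ; links-complete = λ where
        (here refl) (here refl) y~y → contradiction y~y ~-irrefl
        (here refl) (there z∈S) y~z → inj₂ (here (cong (_, y) (y~S z∈S y~z)))
        (there x∈S) (here refl) x~y → inj₁ (here (cong (_, y) (y~S x∈S (~-sym x~y))))
        (there x∈S) (there z∈S) x~z → Sum.map there there (links-complete L x∈S z∈S x~z)
    ; weights        = cong₂ _∷_ (cong₂ ∣_-_∣ bottom new) (trans
        (map-cong-local (All.map (λ (x∈S , z∈S , _) → cong₂ ∣_-_∣ (old x∈S) (old z∈S))
                                 (links-sound L)))
        (weights L))
    } , bottom , top
    where
    n = size L
    f : Vertex → ℕ
    f = label L [ y ≔ odd n ]
    new : f y ≡ odd n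
    new = lookup-≔ (label L) y (odd n)
    old : ∀ {x} → x ∈ S → f x ≡ label L x
    old = lookup-≔-fresh (label L) (odd n) y∉S
    bottom : f c ≡ 0
    bottom = trans (old c∈S) fc≡0
    top : suc (f y) ≡ 2 * suc n
    top = trans (cong suc (trans new (+-comm (2 * n) 1))) (sym (*-suc 2 n))
    below : ∀ {x} → x ∈ S → f x < f y
    below x∈S = subst₂ _<_ (sym (old x∈S)) (sym (trans new (+-comm (2 * n) 1))) (bounded L x∈S)

  -- Joining all leaves at one vertex.

  Rooted : Vertex → List Vertex → Set
  Rooted c S = c ∈ S × ∃ λ (L : Labelling 0 S) → label L c ≡ 0

  attachAll : ∀ {c S} {P : Pred Vertex 0ℓ} → Decidable P →
              (∀ {y} → P y → c ~ y × (∀ {z} → y ~ z → z ≡ c)) →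
              ∀ ys → Rooted c S → ∃ λ T → Rooted c T × (_∈ T) ≐ (_∈ S) ∪ (P ∩ (_∈ ys))
  attachAll P? pendant [] R = _ , R , inj₁ , λ { (inj₁ x∈S) → x∈S ; (inj₂ (_ , ())) }
  attachAll {c} {S} {P} P? pendant (y ∷ ys) R
    with attachAll P? pendant ys R
  ... | T , R′@(c∈T , L , Lc≡0) , fwd , bwd with P? y | y ∈? T
  ... | no ¬Py | _ = T , R′ , Sum.map₂ (λ (p , q) → p , there q) ∘ fwd , λ where
        (inj₁ x∈S) → bwd (inj₁ x∈S)
        (inj₂ (Px , here refl)) → contradiction Px ¬Py
        (inj₂ (Px , there x∈ys)) → bwd (inj₂ (Px , x∈ys))
  -- A vertex already present is skipped. This occurs at the first joint, where one leaf was used to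
  -- start the component.
  ... | yes _ | yes y∈T = T , R′ , Sum.map₂ (λ (p , q) → p , there q) ∘ fwd , λ where
        (inj₁ x∈S) → bwd (inj₁ x∈S)
        (inj₂ (Px , here refl)) → y∈T
        (inj₂ (Px , there x∈ys)) → bwd (inj₂ (Px , x∈ys))
  ... | yes Py | no y∉T
    with c~y , only ← pendant Py
    with L′ , L′c≡0 , _ ← attach (loosen L) c∈T Lc≡0 y∉T c~y (λ _ → only)
    = y ∷ T , (there c∈T , L′ , L′c≡0) , (λ where
        (here refl) → inj₂ (Py , here refl)
        (there x∈T) → Sum.map₂ (λ (p , q) → p , there q) (fwd x∈T)) , λ where
        (inj₁ x∈S) → there (bwd (inj₁ x∈S))
        (inj₂ (Px , here refl)) → here refl
        (inj₂ (Px , there x∈ys)) → there (bwd (inj₂ (Px , x∈ys)))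

  -- Unions of components, and spines.

  vertices : List Vertex
  vertices = map vertexAt (allFin order)

  ∈-vertices : ∀ x → x ∈ vertices
  ∈-vertices x = subst (_∈ vertices) (Inverse.strictlyInverseʳ enumeration x)
    (∈-map⁺ vertexAt (∈-allFin (Inverse.to enumeration x)))

  -- Such a set is a union of connected components, so a component with one vertex outside it is
  -- disjoint from it.
  Closed : List Vertex → Set
  Closed S = ∀ {x y} → x ∈ S → x ~ y → y ∈ S

  closed-reachable : ∀ {S x y} → Closed S → Reachable graph x y → x ∈ S → y ∈ S
  closed-reachable cl ε         x∈S = x∈S
  closed-reachable cl (e ◅ x⇝y) x∈S = closed-reachable cl x⇝y (cl x∈S e)

  reachable-sym : ∀ {x y} → Reachable graph x y → Reachable graph y x
  reachable-sym = Star.reverse ~-sym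

  -- The component of x may have no joints: it is then K₂.
  record Spine (x : Vertex) : Set where
    field
      {len}        : ℕ
      joint        : Fin len → Vertex
      joint-inj    : Injective _≡_ _≡_ joint
      reach        : ∀ i → Reachable graph x (joint i)
      adjacent     : ∀ {i j} → joint i ~ joint j ⇔ (toℕ j ≡ suc (toℕ i) ⊎ toℕ i ≡ suc (toℕ j))
      branching    : ∀ i → ¬ IsLeaf graph (joint i)
      pendant      : ∀ {y u v} → Reachable graph x y → ¬ (∃ λ i → joint i ≡ y) →
                     y ~ u → y ~ v → u ≡ v

  Extension : Vertex → List Vertex → Set
  Extension x S = ∃ λ T → Labelling 0 T × Closed T × x ∈ T × S ⊆ T

  -- A component starts with an edge: isolating `x` costs slack 1, and joining `y` at once restores
  -- slack 0. As `S` is closed and misses `x`, no edge runs from `x` into `S`.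
  addEdge : ∀ {S x y} → Labelling 0 S → Closed S → x ∉ S → y ∉ S → x ~ y →
            (∀ {z} → y ~ z → z ≡ x) → Rooted x (y ∷ x ∷ S)
  addEdge {S} {x} {y} L cl x∉S y∉S x~y only =
    let L₁ , L₁x≡0     = isolate L x∉S (λ z∈S x~z → x∉S (cl z∈S (~-sym x~z)))
        L₂ , L₂x≡0 , _ = attach L₁ (here refl) L₁x≡0 y∉ x~y (λ _ → only)
    in there (here refl) , L₂ , L₂x≡0
    where
    y∉ : y ∉ x ∷ S
    y∉ (here refl) = ~-irrefl x~y
    y∉ (there y∈S) = y∉S y∈S

  -- Adding whole components.

  module _ (hasNeighbour : ∀ x → ∃ (x ~_)) where

    addComponent : ∀ {x S} → Spine x → Labelling 0 S → Closed S → x ∉ S → Extension x S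
    -- Without joints every vertex of the component has at most one neighbour, so `x` and its
    -- neighbour are the whole component.
    addComponent {x} {S} record { len = zero ; pendant = pendant } L cl x∉S
      = let x∈T , L′ , _ = addEdge L cl x∉S (λ y∈S → x∉S (cl y∈S (~-sym x~y))) x~y
                             (λ y~z → pendant (x~y ◅ ε) (λ ()) y~z (~-sym x~y))
        in y ∷ x ∷ S , L′ , cl′ , x∈T , there ∘ there
      where
      y = proj₁ (hasNeighbour x)
      x~y = proj₂ (hasNeighbour x)

      cl′ : Closed (y ∷ x ∷ S)
      cl′ (here refl)         y~z = there (here (pendant (x~y ◅ ε) (λ ()) y~z (~-sym x~y)))
      cl′ (there (here refl)) x~z = here (pendant ε (λ ()) x~z x~y)
      cl′ (there (there v∈S)) v~z = there (there (cl v∈S v~z))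
    addComponent {x} {S} sp@record { len = suc k } L cl x∉S
      = finish (stage (fromℕ k))
      where
      open Spine sp

      OnSpine : Pred Vertex 0ℓ
      OnSpine y = ∃ λ i → joint i ≡ y

      onSpine? : Decidable OnSpine
      onSpine? y = Fin.any? λ i → joint i ≟ y

      Pendant : Fin (suc k) → Pred Vertex 0ℓ
      Pendant i y = joint i ~ y × ¬ OnSpine y

      pendant? : ∀ i → Decidable (Pendant i)
      pendant? i y = (joint i ~? y) ×-dec ¬? (onSpine? y)

      pendant-only : ∀ {i y z} → Pendant i y → y ~ z → z ≡ joint i
      pendant-only {i} (i~y , off) y~z = pendant (reach i ◅◅ i~y ◅ ε) off y~z (~-sym i~y)

      Reached : Fin (suc k) → Pred Vertex 0ℓ
      Reached c y = ∃ λ j → j Fin.≤ c × (joint j ≡ y ⊎ Pendant j y)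

      unlabelled : ∀ {y} → Reachable graph x y → y ∉ S
      unlabelled x⇝y y∈S = x∉S (closed-reachable cl (reachable-sym x⇝y) y∈S)

      -- The invariant of the walk along the spine. The labelled set is described exactly, since the
      -- next joint must be seen to be new and to have a single labelled neighbour.
      Stage : Fin (suc k) → Set
      Stage c = ∃ λ T → Rooted (joint c) T × (_∈ T) ≐ (_∈ S) ∪ Reached c

      -- Otherwise all neighbours of the first joint are joints. Having no predecessor on the spine,
      -- it is adjacent to the second joint only, so it is a leaf, against `branching`.
      firstPendant : ∃ (Pendant Fin.zero)
      firstPendant with Fin.any? (λ i → pendant? Fin.zero (vertexAt i))
      ... | yes (i , p) = vertexAt i , p
      ... | no none with w , s₀~w ← hasNeighbour (joint Fin.zero) =
        contradiction (w , s₀~w , λ s₀~v → trans (sym (proj₂ (second s₀~w)))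
                         (trans (cong joint (same s₀~w s₀~v)) (proj₂ (second s₀~v))))
                      (branching Fin.zero)
        where
        second : ∀ {v} → joint Fin.zero ~ v → OnSpine v
        second {v} s₀~v = decidable-stable (onSpine? v) λ off → none
          (Inverse.to enumeration v ,
           subst (Pendant Fin.zero) (sym (Inverse.strictlyInverseʳ enumeration v)) (s₀~v , off))

        index : ∀ {v} (e : joint Fin.zero ~ v) → toℕ (proj₁ (second e)) ≡ 1
        index e with second e
        ... | j , refl with Equivalence.to adjacent e
        ...   | inj₁ j≡1 = j≡1

        same : ∀ {u v} (d : joint Fin.zero ~ u) (e : joint Fin.zero ~ v) →
               proj₁ (second d) ≡ proj₁ (second e)
        same d e = Fin.toℕ-injective (trans (index d) (sym (index e)))

      withPendants : ∀ {T} c → Rooted (joint c) T →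
                     ∃ λ T′ → Rooted (joint c) T′ × (_∈ T′) ≐ (_∈ T) ∪ Pendant c
      withPendants c R
        with T′ , R′ , fwd , bwd ←
          attachAll (pendant? c) (λ p → proj₁ p , pendant-only p) vertices R
        = T′ , R′ , Sum.map₂ proj₁ ∘ fwd , bwd ∘ Sum.map₂ (_, ∈-vertices _)

      stage-zero : Stage Fin.zero
      stage-zero =
        let T , R , fwd , bwd = withPendants Fin.zero
              (addEdge L cl (unlabelled (reach Fin.zero)) (unlabelled (reach Fin.zero ◅◅ s₀~w ◅ ε))
                       s₀~w (pendant-only p))
        in T , R , to ∘ fwd , bwd ∘ from
        where
        w = proj₁ firstPendant
        p = proj₂ firstPendant
        s₀~w = proj₁ p

        to : ∀ {y} → y ∈ w ∷ joint Fin.zero ∷ S ⊎ Pendant Fin.zero y →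
             y ∈ S ⊎ Reached Fin.zero y
        to (inj₁ (here refl))         = inj₂ (Fin.zero , z≤n , inj₂ p)
        to (inj₁ (there (here refl))) = inj₂ (Fin.zero , z≤n , inj₁ refl)
        to (inj₁ (there (there y∈S))) = inj₁ y∈S
        to (inj₂ q)                   = inj₂ (Fin.zero , z≤n , inj₂ q)
        from : ∀ {y} → y ∈ S ⊎ Reached Fin.zero y →
               y ∈ w ∷ joint Fin.zero ∷ S ⊎ Pendant Fin.zero y
        from (inj₁ y∈S)                             = inj₁ (there (there y∈S))
        from (inj₂ (Fin.zero , _ , inj₁ refl)) = inj₁ (there (here refl))
        from (inj₂ (Fin.zero , _ , inj₂ q))    = inj₂ q

      stage-suc : ∀ i → Stage (inject₁ i) → Stage (Fin.suc i)
      stage-suc i (T , (c∈T , M , Mc≡0) , fwd , bwd)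
        = let M₁ , _ , top = attach (loosen M) c∈T Mc≡0 fresh c~y only
              T′ , R′ , fwd′ , bwd′ = withPendants (Fin.suc i)
                -- The new joint has label 2n - 1 by `top`, so complementing moves it to 0, ready
                -- for its own leaves.
                (here refl , flip M₁ , trans (cong (2 * size M₁ ∸_) top) (n∸n≡0 (2 * size M₁)))
          in T′ , R′ , to ∘ fwd′ , bwd′ ∘ from
        where
        c = inject₁ i

        earlier : ∀ {j} → j Fin.≤ c → j Fin.< Fin.suc i
        earlier {j} j≤c = s≤s (subst (toℕ j ≤_) (Fin.toℕ-inject₁ i) j≤c)

        c~y : joint c ~ joint (Fin.suc i)
        c~y = Equivalence.from adjacent (inj₁ (cong suc (sym (Fin.toℕ-inject₁ i))))

        fresh : joint (Fin.suc i) ∉ T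
        fresh y∈T with fwd y∈T
        ... | inj₁ y∈S = unlabelled (reach (Fin.suc i)) y∈S
        ... | inj₂ (j , j≤c , inj₁ e) = Fin.<⇒≢ (earlier j≤c) (joint-inj e)
        ... | inj₂ (j , j≤c , inj₂ (_ , off)) = off (Fin.suc i , refl)

        -- A neighbour in `S` would put the whole component there. A leaf at an earlier joint is
        -- adjacent to that joint only, and of the joints reached so far only the last has an index
        -- next to `Fin.suc i`.
        only : ∀ {z} → z ∈ T → joint (Fin.suc i) ~ z → z ≡ joint c
        only z∈T y~z with fwd z∈T
        ... | inj₁ z∈S = contradiction z∈S (unlabelled (reach (Fin.suc i) ◅◅ y~z ◅ ε))
        ... | inj₂ (j , j≤c , inj₂ p) = contradiction (joint-inj (pendant-only p (~-sym y~z)))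
                                                     (Fin.<⇒≢ (earlier j≤c) ∘ sym)
        ... | inj₂ (j , j≤c , inj₁ refl) with Equivalence.to adjacent y~z
        ...   | inj₁ j≡2+i = contradiction (subst (_≤ suc (toℕ i)) j≡2+i (<⇒≤ (earlier j≤c))) 1+n≰n
        ...   | inj₂ e     = cong joint (Fin.toℕ-injective
                               (trans (sym (suc-injective e)) (sym (Fin.toℕ-inject₁ i))))

        to : ∀ {y} → y ∈ joint (Fin.suc i) ∷ T ⊎ Pendant (Fin.suc i) y →
             y ∈ S ⊎ Reached (Fin.suc i) y
        to (inj₁ (here refl)) = inj₂ (Fin.suc i , ≤-refl , inj₁ refl)
        to (inj₁ (there y∈T)) =
          Sum.map₂ (λ (j , j≤c , r) → j , <⇒≤ (earlier j≤c) , r) (fwd y∈T)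
        to (inj₂ p)           = inj₂ (Fin.suc i , ≤-refl , inj₂ p)

        from : ∀ {y} → y ∈ S ⊎ Reached (Fin.suc i) y →
               y ∈ joint (Fin.suc i) ∷ T ⊎ Pendant (Fin.suc i) y
        from (inj₁ y∈S) = inj₁ (there (bwd (inj₁ y∈S)))
        from (inj₂ (j , j≤1+i , r)) with m≤n⇒m<n∨m≡n j≤1+i
        ... | inj₁ (s≤s j≤i) = inj₁ (there (bwd (inj₂
                (j , subst (toℕ j ≤_) (sym (Fin.toℕ-inject₁ i)) j≤i , r))))
        ... | inj₂ j≡1+i with refl ← Fin.toℕ-injective {i = j} {j = Fin.suc i} j≡1+i =
          Sum.map (here ∘ sym) (λ p → p) r

      stage : ∀ c → Stage c
      stage = <-weakInduction Stage stage-zero stage-suc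

      finish : Stage (fromℕ k) → Extension x S
      finish (T , (_ , M , _) , fwd , bwd) =
        -- The start vertex `x` may be a joint or a leaf; either way closedness carries membership
        -- to it along a path from the first joint.
        T , M , cl′ , closed-reachable cl′ (reachable-sym (reach Fin.zero)) (joint∈T Fin.zero) ,
        bwd ∘ inj₁
        where
        joint∈T : ∀ i → joint i ∈ T
        joint∈T i = bwd (inj₂ (i , Fin.≤fromℕ i , inj₁ refl))

        cl′ : Closed T
        cl′ {y} {z} y∈T y~z with fwd y∈T
        ... | inj₁ y∈S = bwd (inj₁ (cl y∈S y~z))
        ... | inj₂ (j , _ , inj₂ p) = subst (_∈ T) (sym (pendant-only p y~z)) (joint∈T j)
        ... | inj₂ (j , _ , inj₁ refl) with onSpine? z
        ...   | yes (i , refl) = joint∈T i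
        ...   | no off = bwd (inj₂ (j , Fin.≤fromℕ j , inj₂ (y~z , off)))

    -- Each vertex not yet labelled stands for a new component, which is added whole; a vertex
    -- already labelled needs no work.
    labelAll : (∀ x → Spine x) → ∀ ys → ∃ λ T → Labelling 0 T × Closed T × All (_∈ T) ys
    labelAll spine [] = [] , empty , (λ ()) , []
    labelAll spine (y ∷ ys)
      with T , L , cl , ys⊆T ← labelAll spine ys
      with y ∈? T
    ... | yes y∈T = T , L , cl , y∈T ∷ ys⊆T
    ... | no y∉T
      with T′ , L′ , cl′ , y∈T′ , T⊆T′ ← addComponent (spine y) L cl y∉T
      = T′ , L′ , cl′ , y∈T′ ∷ All.map T⊆T′ ys⊆T

  -- From a labelling of all vertices to odd-gracefulness.

  module _ {S} (all∈ : ∀ x → x ∈ S) (L : Labelling 0 S) where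

    index : Vertex → Fin order
    index = Inverse.to enumeration

    vertexAt-index : ∀ x → vertexAt (index x) ≡ x
    vertexAt-index = Inverse.strictlyInverseʳ enumeration

    index-vertexAt : ∀ i → index (vertexAt i) ≡ i
    index-vertexAt = Inverse.strictlyInverseˡ enumeration

    -- Links are oriented by the order of construction, whereas `edges` puts the smaller index
    -- first; sorting the indices makes the two lists comparable.
    sort₂ : Fin order → Fin order → Fin order × Fin order
    sort₂ i j with i Fin.<? j
    ... | yes _ = i , j
    ... | no  _ = j , i

    sort₂-< : ∀ {i j} → i Fin.< j → sort₂ i j ≡ (i , j)
    sort₂-< {i} {j} i<j with i Fin.<? j
    ... | yes _   = refl
    ... | no  i≮j = contradiction i<j i≮j

    sort₂-> : ∀ {i j} → i Fin.< j → sort₂ j i ≡ (i , j)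
    sort₂-> {i} {j} i<j with j Fin.<? i
    ... | yes j<i = contradiction i<j (<⇒≯ j<i)
    ... | no  _   = refl

    orient : Vertex × Vertex → Fin order × Fin order
    orient (x , y) = sort₂ (index x) (index y)

    weightAt : Fin order × Fin order → ℕ
    weightAt (i , j) = weight (label L) (vertexAt i , vertexAt j)

    weightAt-orient : ∀ e → weightAt (orient e) ≡ weight (label L) e
    weightAt-orient (x , y) with index x Fin.<? index y
    ... | yes _ = cong₂ (λ u v → weight (label L) (u , v)) (vertexAt-index x) (vertexAt-index y)
    ... | no  _ = trans
      (cong₂ (λ u v → weight (label L) (u , v)) (vertexAt-index y) (vertexAt-index x))
      (∣-∣-comm (label L y) (label L x))

    weights-orient : map weightAt (map orient (links L)) ≡ applyDownFrom odd (size L)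
    weights-orient = trans (sym (map-∘ (links L)))
      (trans (map-cong-local (All.universal weightAt-orient (links L))) (weights L))

    ∈-edges⁺ : ∀ {i j} → i Fin.< j → vertexAt i ~ vertexAt j → (i , j) ∈ edges
    ∈-edges⁺ i<j e = ∈-filter⁺ _ (∈-cartesianProduct⁺ (∈-allFin _) (∈-allFin _)) (i<j , e)

    ∈-edges⁻ : ∀ {i j} → (i , j) ∈ edges → i Fin.< j × vertexAt i ~ vertexAt j
    ∈-edges⁻ = proj₂ ∘ ∈-filter⁻ _ {xs = cartesianProduct (allFin order) (allFin order)}

    orient∈edges : ∀ x y → x ~ y → orient (x , y) ∈ edges
    orient∈edges x y x~y with index x Fin.<? index y
    ... | yes x<y = ∈-edges⁺ x<y (subst₂ _~_ (sym (vertexAt-index x)) (sym (vertexAt-index y)) x~y)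
    ... | no  x≮y = ∈-edges⁺ (≤∧≢⇒< (≮⇒≥ x≮y) (distinct ∘ Fin.toℕ-injective))
      (subst₂ _~_ (sym (vertexAt-index y)) (sym (vertexAt-index x)) (~-sym x~y))
      where
      distinct : index y ≢ index x
      distinct e = ~-irrefl (subst (x ~_)
        (trans (sym (vertexAt-index y)) (trans (cong vertexAt e) (vertexAt-index x))) x~y)

    orient-< : ∀ {i j} → i Fin.< j → orient (vertexAt i , vertexAt j) ≡ (i , j)
    orient-< i<j = trans (cong₂ sort₂ (index-vertexAt _) (index-vertexAt _)) (sort₂-< i<j)

    orient-> : ∀ {i j} → i Fin.< j → orient (vertexAt j , vertexAt i) ≡ (i , j)
    orient-> i<j = trans (cong₂ sort₂ (index-vertexAt _) (index-vertexAt _)) (sort₂-> i<j)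

    links∼edges : map orient (links L) ∼[ set ] edges
    links∼edges = mk⇔ to from
      where
      to : ∀ {e} → e ∈ map orient (links L) → e ∈ edges
      to e∈ with (x , y) , xy∈ , refl ← ∈-map⁻ orient e∈ =
        orient∈edges x y (proj₂ (proj₂ (All.lookup (links-sound L) xy∈)))

      from : ∀ {e} → e ∈ edges → e ∈ map orient (links L)
      from {i , j} e∈ with i<j , i~j ← ∈-edges⁻ e∈ | links-complete L (all∈ _) (all∈ _) i~j
      ... | inj₁ ij∈ = subst (_∈ map orient (links L)) (orient-< i<j) (∈-map⁺ orient ij∈)
      ... | inj₂ ji∈ = subst (_∈ map orient (links L)) (orient-> i<j) (∈-map⁺ orient ji∈)

    odd-injective : ∀ {i j} → odd i ≡ odd j → i ≡ j
    odd-injective {i} {j} e = *-cancelˡ-≡ i j 2 (+-cancelʳ-≡ 1 (2 * i) (2 * j) e)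

    -- Distinct weights make the links pairwise distinct as unordered pairs.
    size≡edgeCount : size L ≡ edgeCount
    size≡edgeCount = trans (sym (length-map orient (links L)))
      (↭-length (∼bag⇒↭ (unique∧set⇒bag links! edges! links∼edges)))
      where
      links! : Unique (map orient (links L))
      links! = Unique.map⁻ (subst Unique (sym weights-orient)
        (Unique.applyDownFrom⁺₁ odd (size L) λ j<i _ → <⇒≢ j<i ∘ sym ∘ odd-injective))

      edges! : Unique edges
      edges! = Unique.filter⁺ _ (Unique.cartesianProduct⁺ (Unique.allFin⁺ order) (Unique.allFin⁺ order))

    labelling⇒oddGraceful : OddGraceful F
    labelling⇒oddGraceful =
      subst (λ n → ∃ λ (f : Vertex → Fin (2 * n)) →
               Injective _≡_ _≡_ f × inducedWeights F (toℕ ∘ f) ≐ firstOdds n)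
            size≡edgeCount
            (f , f-injective , to , from)
      where
      f : Vertex → Fin (2 * size L)
      f x = fromℕ< (bounded L (all∈ x))

      toℕ-f : ∀ x → toℕ (f x) ≡ label L x
      toℕ-f x = Fin.toℕ-fromℕ< _

      f-injective : Injective _≡_ _≡_ f
      f-injective {x} {y} e = injective L (all∈ x) (all∈ y)
        (trans (sym (toℕ-f x)) (trans (cong toℕ e) (toℕ-f y)))

      weight∈ : ∀ {x y} → x ~ y → weight (label L) (x , y) ∈ applyDownFrom odd (size L)
      weight∈ {x} {y} x~y = subst (weight (label L) (x , y) ∈_) (weights L)
        (case links-complete L (all∈ x) (all∈ y) x~y of λ where
          (inj₁ xy∈) → ∈-map⁺ (weight (label L)) xy∈
          (inj₂ yx∈) → subst (_∈ map (weight (label L)) (links L)) (∣-∣-comm (label L y) (label L x))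
                         (∈-map⁺ (weight (label L)) yx∈))

      to : ∀ {w} → inducedWeights F (toℕ ∘ f) w → firstOdds (size L) w
      to (x , y , x~y , refl) =
        let i , i<n , e = ∈-applyDownFrom⁻ odd (weight∈ x~y)
        in i , i<n , trans (cong₂ ∣_-_∣ (toℕ-f x) (toℕ-f y)) e

      from : ∀ {w} → firstOdds (size L) w → inducedWeights F (toℕ ∘ f) w
      from (i , i<n , refl) =
        let (x , y) , xy∈ , e = ∈-map⁻ (weight (label L))
              (subst (odd i ∈_) (sym (weights L)) (∈-applyDownFrom⁺ odd i<n))
        in x , y , proj₂ (proj₂ (All.lookup (links-sound L) xy∈)) ,
           trans e (sym (cong₂ ∣_-_∣ (toℕ-f x) (toℕ-f y)))

  -- The spine of a caterpillar component.

  module _ {x} (caterpillar : IsCaterpillar (component graph x)) where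
    private
      C = component graph x
      module C = Graph C

    forget : ∀ {u v} → Reachable C u v → Reachable graph (value u) (value v)
    forget = Star.gmap value (λ e → e)

    root : C.Vertex
    root = x , [ ε ]

    step : ∀ (u : C.Vertex) {v} → value u ~ v → C.Vertex
    step u {v} e = v , Irrelevant.map (λ p → p ◅◅ e ◅ ε) (proof u)

    -- The membership proof stored in `u` is irrelevant and yields no path to compute with;
    -- connectedness of the component supplies one.
    reachable-in : ∀ u → Reachable graph x (value u)
    reachable-in u = forget (proj₂ (proj₁ (proj₁ caterpillar)) root u)

    leaf⇒leaf : ∀ {u} → IsLeaf graph (value u) → IsLeaf C u
    leaf⇒leaf {u} (z , e , unique) = step u e , e , λ d → value-injective (unique d)

    -- Irrelevance of the refutation does no harm, because it only serves to reach the empty type.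
    refute : ∀ {P : Set} → Irrelevant (¬ P) → ¬ P
    refute [ ¬p ] p = ⊥-elim-irr (¬p p)

    spine : Spine x
    spine with k , iso ← proj₂ caterpillar = record
      { joint     = joint
      ; joint-inj = λ e → trans (sym (strictlyInverseˡ _)) (trans
          (cong to (value-injective (value-injective e))) (strictlyInverseˡ _))
      ; reach     = λ i → reachable-in (value (from i))
      ; adjacent  = λ {i} {j} → subst₂ (λ i′ j′ → joint i ~ joint j ⇔ Graph._~_ (pathGraph k) i′ j′)
          (strictlyInverseˡ i) (strictlyInverseˡ j) (adjacency (from i) (from j))
      ; branching = λ i leaf → refute (proof (from i)) (leaf⇒leaf {value (from i)} leaf)
      ; pendant   = pendant
      }
      where
      open _≅_ iso
      open Inverse bijection using (to; from; strictlyInverseˡ; strictlyInverseʳ)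

      joint : Fin k → Vertex
      joint i = value (value (from i))

      pendant : ∀ {y u v} → Reachable graph x y → ¬ (∃ λ i → joint i ≡ y) →
                y ~ u → y ~ v → u ≡ v
      -- Two distinct neighbours would keep `y` from being a leaf of the component, so `y` would
      -- survive the removal of leaves and be a joint.
      pendant {y} {u} {v} x⇝y off y~u y~v = decidable-stable (u ≟ v) λ u≢v →
        let inner = (y , [ x⇝y ]) , [ (λ (_ , _ , unique) → u≢v (trans
              (sym (cong value (unique {step (y , [ x⇝y ]) y~u} y~u)))
              (cong value (unique {step (y , [ x⇝y ]) y~v} y~v)))) ]
        in off (to inner , cong (value ∘ value) (strictlyInverseʳ inner))

    -- Follow a path from `x` to an end of the given edge: its first step gives a neighbour, and if
    -- it is empty the edge itself starts at `x`.
    hasNeighbour : HasEdge C → ∃ (x ~_)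
    hasNeighbour (u , v , u~v) with reachable-in u
    ... | ε       = value v , u~v
    ... | e ◅ _ = _ , e

theorem2 : (F : FiniteGraph) (let open FiniteGraph F) →
    IsForest graph →
    ((x : Vertex) → IsCaterpillar (component graph x) × HasEdge (component graph x)) →
    OddGraceful F
theorem2 F _ components =
  let _ , L , _ , all∈ = labelAll F (λ x → hasNeighbour F (proj₁ (components x)) (proj₂ (components x)))
                           (λ x → spine F (proj₁ (components x))) (vertices F)
  in labelling⇒oddGraceful F (λ x → All.lookup all∈ (∈-vertices F x)) L
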